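{- Let $(S,T,\to,\hat s)$ be a transition system with deterministic transitions and initial state $\hat s$, such that $T$ is finite and only finitely many states are reachable. Let $\mathcal{T}$ be an assignment of a set $\mathcal{T}(s)\subseteq T$ to each $s\in S$ such that D0, D1 and D2 hold at every $s_0\in S$. Assume that the system is AG EF terminating, i.e. from every reachable state, a terminal state is reachable. Let $t_\omega\in T$ and $T_*\subseteq T$. Then the full state space contains an execution where $t_\omega$ occurs infinitely many times but no member of $T_*$ occurs infinitely many times if and only if the reduced state space induced by $\mathcal{T}$ contains such an execution.
   Context: $S$ is a set of states, $T$ a set of transitions, and $\hat s\in S$ the initial state. We write $s\xrightarrow{t}s'$ if transition $t\in T$ is enabled at $s\in S$ and firing it at $s$ yields $s'$; we write $s\xrightarrow{t}$ if $t$ is enabled at $s$, i.e. if $s\xrightarrow{t}s'$ for some $s'$. Transitions are deterministic: if $s\xrightarrow{t}s_1$ and $s\xrightarrow{t}s_2$ then $s_1=s_2$. The notation extends to finite (possibly empty) sequences: $s\xrightarrow{t_1\cdots t_n}s'$. A state is terminal if no transition is enabled at it. A state $s'$ is reachable from $s$ if $s\xrightarrow{t_1\cdots t_n}s'$ for some finite, possibly empty, sequence; a state is reachable if it is reachable from $\hat s$. The full state space is the directed graph of reachable states and the edges $s\xrightarrow{t}s'$ between them. Stubborn sets (basic strong stubborn set method): each $s\in S$ is assigned a set $\mathcal{T}(s)\subseteq T$ such that for every $s_0\in S$, every $t\in\mathcal{T}(s_0)$ and all $t_1,\dots,t_n\notin\mathcal{T}(s_0)$: D0: if $s_0$ is not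 terminal, then $\mathcal{T}(s_0)$ contains a transition enabled at $s_0$. D1: if $s_0\xrightarrow{t_1\cdots t_n t}s'_n$, then $s_0\xrightarrow{t t_1\cdots t_n}s'_n$. D2: if $s_0\xrightarrow{t}$ and $s_0\xrightarrow{t_1\cdots t_n}s_n$, then $s_n\xrightarrow{t}$. The reduced state space is the smallest directed graph that contains $\hat s$ and such that, for each of its states $s$ and each $t\in\mathcal{T}(s)$ with $s\xrightarrow{t}s'$, it contains the edge $s\xrightarrow{t}s'$ and the state $s'$. An (infinite) execution of the full (respectively reduced) state space is an infinite path $\hat s\xrightarrow{t_1}s_1\xrightarrow{t_2}s_2\cdots$ starting at $\hat s$ all of whose edges belong to the full (respectively reduced) state space; a transition $t$ occurs infinitely many times in it if $t_i=t$ for infinitely many $i$. -}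

module Defs where

open import Data.List.Base using (List; []; _∷_; _++_; [_])
open import Data.List.Membership.Propositional using () renaming (_∈_ to _∈ˡ_)
open import Data.List.Relation.Unary.All using (All)
open import Data.Nat.Base using (ℕ; zero; suc; _≤_)
open import Data.Product.Base using (Σ; ∃-syntax; _×_)
open import Level using (0ℓ)
open import Relation.Binary.PropositionalEquality.Core using (_≡_)
open import Relation.Nullary.Negation.Core using (¬_)
open import Relation.Unary using (Pred; _∈_; _∉_; _⊆_)

Finite : {A : Set} → Pred A 0ℓ → Set
Finite {A} P = ∃[ xs ] P ⊆ (λ (x : A) → x ∈ˡ xs)

record TransitionSystem : Set₁ where
  infix 4 _-[_]→_
  field
    State         : Set
    Transition    : Set
    _-[_]→_       : State → Transition → State → Set
    initial       : State
    deterministic : ∀ {s t s₁ s₂} → s -[ t ]→ s₁ → s -[ t ]→ s₂ → s₁ ≡ s₂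

module _ (M : TransitionSystem) where
  open TransitionSystem M

  Enabled : State → Pred Transition 0ℓ
  Enabled s t = ∃[ s′ ] s -[ t ]→ s′

  Terminal : Pred State 0ℓ
  Terminal s = ¬ (∃[ t ] Enabled s t)

  data Fires : State → List Transition → State → Set where
    []  : ∀ {s} → Fires s [] s
    _∷_ : ∀ {s t s′ ts s″} → s -[ t ]→ s′ → Fires s′ ts s″ → Fires s (t ∷ ts) s″

  ReachableFrom : State → Pred State 0ℓ
  ReachableFrom s s′ = ∃[ ts ] Fires s ts s′

  Reachable : Pred State 0ℓ
  Reachable = ReachableFrom initial

  AGEFTerminating : Set
  AGEFTerminating =
    ∀ s → Reachable s → ∃[ s′ ] (Terminal s′ × ReachableFrom s s′)

  record IsStubborn (𝒯 : State → Pred Transition 0ℓ) : Set where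
    field
      D0 : ∀ s₀ → ¬ Terminal s₀ → ∃[ t ] (t ∈ 𝒯 s₀ × Enabled s₀ t)
      D1 : ∀ s₀ t ts sₙ′ → t ∈ 𝒯 s₀ → All (_∉ 𝒯 s₀) ts →
           Fires s₀ (ts ++ [ t ]) sₙ′ → Fires s₀ (t ∷ ts) sₙ′
      D2 : ∀ s₀ t ts sₙ → t ∈ 𝒯 s₀ → All (_∉ 𝒯 s₀) ts →
           Enabled s₀ t → Fires s₀ ts sₙ → Enabled sₙ t

  FullEdge : State → Transition → State → Set
  FullEdge s t s′ = Reachable s × Reachable s′ × s -[ t ]→ s′

  -- The smallest graph closed under the given conditions, as an inductive
  -- definition of its states and edges.
  mutual
    data ReducedState (𝒯 : State → Pred Transition 0ℓ) : State → Set where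
      init   : ReducedState 𝒯 initial
      target : ∀ {s t s′} → ReducedEdge 𝒯 s t s′ → ReducedState 𝒯 s′

    data ReducedEdge (𝒯 : State → Pred Transition 0ℓ) :
                     State → Transition → State → Set where
      edge : ∀ {s t s′} → ReducedState 𝒯 s → t ∈ 𝒯 s → s -[ t ]→ s′ →
             ReducedEdge 𝒯 s t s′

  record Execution (Edge : State → Transition → State → Set) : Set where
    field
      state  : ℕ → State
      label  : ℕ → Transition
      starts : state zero ≡ initial
      steps  : ∀ i → Edge (state i) (label i) (state (suc i))

  OccursInfinitelyOften : ∀ {Edge} → Execution Edge → Pred Transition 0ℓ
  OccursInfinitelyOften e t = ∀ n → ∃[ i ] (n ≤ i × Execution.label e i ≡ t)

  HasExecution : (Edge : State → Transition → State → Set) →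
                 Transition → Pred Transition 0ℓ → Set
  HasExecution Edge tω T* =
    Σ (Execution Edge) λ e →
      OccursInfinitelyOften e tω × (∀ t → t ∈ T* → ¬ OccursInfinitelyOften e t)

{-# OPTIONS --safe #-}

-- A full execution visiting tω infinitely often and T* finitely often yields,
-- for every N, a finite path with at least N occurrences of tω and at most C
-- occurrences of T*, where C does not depend on N.  As there are finitely many
-- reachable states, a path of bounded length leads on to a terminal state, so
-- all these paths may be taken to end in terminal states.  D0–D2 permute any
-- path to a terminal state into a path of the reduced state space, and a
-- permutation preserves both counts.  Finally, paths of a finite state space
-- with unboundedly many tω on a budget of C occurrences of T* give an infinite
-- execution: by the infinite pigeonhole principle one can walk through a tω to
-- a state where again unboundedly many tω are possible within what is left of
-- the budget, and this can be repeated forever.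

module Submission where

open import Defs
open import Axiom.DoubleNegationElimination using (em⇒dne)
open import Axiom.ExcludedMiddle using (ExcludedMiddle)
open import Data.List.Base
  using (List; []; _∷_; _++_; [_]; _∷ʳ_; length; filter; cartesianProduct; upTo)
open import Data.List.Membership.Propositional using () renaming (_∈_ to _∈ˡ_)
open import Data.List.Membership.Propositional.Properties
  using (∈-cartesianProduct⁺; ∈-upTo⁺)
open import Data.List.Properties
  using (++-assoc; length-++; length-filter; filter-++; filter-accept; filter-none)
open import Data.List.Relation.Binary.Permutation.Propositional
  using (_↭_; ↭-refl; ↭-sym; ↭-trans; prep)
open import Data.List.Relation.Binary.Permutation.Propositional.Properties
  using (↭-length; shift; filter-↭)
open import Data.List.Relation.Unary.All using (All; []; _∷_)
open import Data.List.Relation.Unary.All.Properties using (++⁺)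
open import Data.List.Relation.Unary.Any using (here; there)
open import Data.List.Relation.Unary.First using (FirstView; first) renaming (_++_∷_ to firstAt)
open import Data.List.Relation.Unary.First.Properties using (toView)
open import Data.Nat.Base
  using (ℕ; zero; suc; _+_; _≤_; _<_; _⊔_; z≤n; s≤s; s≤s⁻¹; _≤′_; ≤′-refl; ≤′-step)
open import Data.Nat.Properties
open import Data.Product.Base using (Σ; ∃-syntax; _×_; _,_; proj₁; proj₂)
open import Data.Sum.Base as Sum using (_⊎_; inj₁; inj₂)
open import Function.Base using (_∘_)
open import Function.Bundles using (_⇔_; mk⇔)
open import Level using (0ℓ)
open import Relation.Binary.PropositionalEquality
  using (_≡_; refl; sym; trans; cong; cong₂; subst)
open import Relation.Nullary using (¬_; yes; no; contradiction)
open import Relation.Nullary.Decidable using (toSum)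
open import Relation.Unary using (Pred; Decidable; U; _∈_; _∉_; _⊆_)

-- Paths, executions and the reduced state space

module _ (M : TransitionSystem) where
  open TransitionSystem M

  Fires-++ : ∀ {s ts s′ us s″} → Fires M s ts s′ → Fires M s′ us s″ → Fires M s (ts ++ us) s″
  Fires-++ []       q = q
  Fires-++ (st ∷ p) q = st ∷ Fires-++ p q

  Fires-split : ∀ {s} ts {us s″} → Fires M s (ts ++ us) s″ →
                ∃[ s′ ] (Fires M s ts s′ × Fires M s′ us s″)
  Fires-split []       p        = _ , [] , p
  Fires-split (t ∷ ts) (st ∷ p) with Fires-split ts p
  ... | s′ , q , r = s′ , st ∷ q , r

  Reachable-Fires : ∀ {s ts s′} → Reachable M s → Fires M s ts s′ → Reachable M s′
  Reachable-Fires (us , p) q = _ , Fires-++ p q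

  Execution-Reachable : (e : Execution M (FullEdge M)) → ∀ i → Reachable M (Execution.state e i)
  Execution-Reachable e i = proj₁ (Execution.steps e i)

  mapExecution : ∀ {E E′ : State → Transition → State → Set} {tω T*} →
                 (∀ {s t s′} → E s t s′ → E′ s t s′) →
                 HasExecution M E tω T* → HasExecution M E′ tω T*
  mapExecution f (e , inf , fin) = record
    { state = state ; label = label ; starts = starts ; steps = f ∘ steps } , inf , fin
    where open Execution e

  -- Presents the reduced state space as the full state space of a system of its own, so that what
  -- is shown about full state spaces applies to it unchanged.
  restrict : (State → Pred Transition 0ℓ) → TransitionSystem
  restrict 𝒯 = record
    { State         = State
    ; Transition    = Transition
    ; _-[_]→_       = λ s t s′ → t ∈ 𝒯 s × s -[ t ]→ s′
    ; initial       = initial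
    ; deterministic = λ (_ , p) (_ , q) → deterministic p q
    }

  module _ {𝒯 : State → Pred Transition 0ℓ} where

    Fires-unrestrict : ∀ {s ts s′} → Fires (restrict 𝒯) s ts s′ → Fires M s ts s′
    Fires-unrestrict []             = []
    Fires-unrestrict ((_ , st) ∷ p) = st ∷ Fires-unrestrict p

    ReducedState-Fires : ∀ {s ts s′} → ReducedState M 𝒯 s →
                         Fires (restrict 𝒯) s ts s′ → ReducedState M 𝒯 s′
    ReducedState-Fires r []               = r
    ReducedState-Fires r ((t∈ , st) ∷ p) = ReducedState-Fires (target (edge r t∈ st)) p

    ReducedState⇒Reachable : ReducedState M 𝒯 ⊆ Reachable M
    ReducedState⇒Reachable init                     = [] , []
    ReducedState⇒Reachable (target (edge r _ st)) =
      Reachable-Fires (ReducedState⇒Reachable r) (st ∷ [])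

    ReducedEdge⇒FullEdge : ∀ {s t s′} → ReducedEdge M 𝒯 s t s′ → FullEdge M s t s′
    ReducedEdge⇒FullEdge (edge r t∈ st) =
      ReducedState⇒Reachable r , ReducedState⇒Reachable (target (edge r t∈ st)) , st

    unrestrictExecution : ∀ {tω T*} →
      HasExecution (restrict 𝒯) (FullEdge (restrict 𝒯)) tω T* →
      HasExecution M (ReducedEdge M 𝒯) tω T*
    unrestrictExecution (e , inf , fin) = record
      { state = state ; label = label ; starts = starts
      ; steps = λ i → reduced (steps i) } , inf , fin
      where
      open Execution e
      reduced : ∀ {s t s′} → FullEdge (restrict 𝒯) s t s′ → ReducedEdge M 𝒯 s t s′
      reduced ((_ , p) , _ , t∈ , st) = edge (ReducedState-Fires init p) t∈ st

-- Descent, finiteness principles and counting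

no-infinite-descent : (f : ℕ → ℕ) → (∀ i → f (suc i) ≤ f i) →
                      ¬ (∀ n → ∃[ i ] (n ≤ i × f (suc i) < f i))
no-infinite-descent f mono drops = below (f 0) 0 ≤-refl
  where
  antitone : ∀ {m n} → m ≤′ n → f n ≤ f m
  antitone ≤′-refl     = ≤-refl
  antitone (≤′-step p) = ≤-trans (mono _) (antitone p)

  -- Induction on the bound `k`: past the next strict drop after `n`, the bound is smaller by one.
  below : ∀ k n → ¬ f n ≤ k
  below k n fn≤k with drops n
  ... | i , n≤i , drop with ≤-trans drop (≤-trans (antitone (≤⇒≤′ n≤i)) fn≤k)
  below (suc k) n fn≤k | i , n≤i , drop | s≤s fi≤k = below k (suc i) fi≤k

module Classical (em : ExcludedMiddle 0ℓ) where

  stable : {P : Set} → ¬ ¬ P → P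
  stable = em⇒dne em

  -- By monotonicity, the maximum of the individual bounds along the enumerating list works. The
  -- list may also contain elements outside `P`, which `em` detects and skips.
  uniformBound : ∀ {A : Set} {P : Pred A 0ℓ} {Q : ℕ → Pred A 0ℓ} → Finite P →
                 (∀ {m n x} → m ≤ n → Q m x → Q n x) →
                 (∀ {x} → x ∈ P → ∃[ n ] Q n x) → ∃[ n ] (∀ {x} → x ∈ P → Q n x)
  uniformBound {A} {P} {Q} (xs , P⊆xs) mono bound with onList xs
    where
    onList : ∀ ys → ∃[ n ] (∀ {x} → x ∈ˡ ys → x ∈ P → Q n x)
    onList []       = 0 , λ ()
    onList (y ∷ ys) with onList ys | em {y ∈ P}
    ... | n , q | no  y∉P = n , λ where
      (here refl) y∈P → contradiction y∈P y∉P
      (there x∈)  x∈P → q x∈ x∈P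
    ... | n , q | yes y∈P with bound y∈P
    ...   | m , qm = m ⊔ n , λ where
      (here refl) _   → mono (m≤m⊔n m n) qm
      (there x∈)  x∈P → mono (m≤n⊔m m n) (q x∈ x∈P)
  ... | n , q = n , λ x∈P → q (P⊆xs x∈P) x∈P

  -- Otherwise each `x` in `P` fails from some `n` on, and `uniformBound` gives one `n` at which all
  -- of them fail.
  infinitePigeonhole : ∀ {A : Set} {P : Pred A 0ℓ} {R : ℕ → Pred A 0ℓ} → Finite P →
                       (∀ {m n x} → m ≤ n → R n x → R m x) →
                       (∀ n → ∃[ x ] (x ∈ P × R n x)) → ∃[ x ] (x ∈ P × ∀ n → R n x)
  infinitePigeonhole {P = P} {R} fin anti holds = stable λ none →
    let n , ¬R = uniformBound {Q = λ n x → ¬ R n x} fin (λ m≤n ¬r r → ¬r (anti m≤n r))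
                   λ x∈P → stable λ all → none (_ , x∈P , λ n → stable λ ¬r → all (n , ¬r))
        x , x∈P , r = holds n
    in ¬R x∈P r

  module _ {A : Set} (P : Pred A 0ℓ) where

    P? : Decidable P
    P? x = em

    count : List A → ℕ
    count xs = length (filter P? xs)

    count-++ : ∀ xs ys → count (xs ++ ys) ≡ count xs + count ys
    count-++ xs ys = trans (cong length (filter-++ P? xs ys)) (length-++ (filter P? xs))

    count-↭ : ∀ {xs ys} → xs ↭ ys → count xs ≡ count ys
    count-↭ p = ↭-length (filter-↭ P? p)

    count≤length : ∀ xs → count xs ≤ length xs
    count≤length = length-filter P?

    count-accept : ∀ {x} xs → x ∈ P → count (x ∷ xs) ≡ suc (count xs)
    count-accept xs x∈P = cong length (filter-accept P? x∈P)

    count-none : ∀ {xs} → All (_∉ P) xs → count xs ≡ 0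
    count-none none = cong length (filter-none P? none)

    findFirst : ∀ xs → FirstView (_∉ P) P xs ⊎ All (_∉ P) xs
    findFirst xs = Sum.map₁ toView (first (λ x → Sum.swap (toSum (P? x))) xs)

  -- Permuting terminating paths by stubborn sets

  module _ (M : TransitionSystem)
           {𝒯 : TransitionSystem.State M → Pred (TransitionSystem.Transition M) 0ℓ}
           (stubborn : IsStubborn M 𝒯) where
    open TransitionSystem M
    open IsStubborn stubborn

    -- A path to a terminal state fires some member of 𝒯 s: otherwise D2 would
    -- keep the transition given by D0 enabled.  D1 moves the first one to the front.
    permuteToReduced : ∀ n {s ts s′} → length ts ≡ n → Fires M s ts s′ → Terminal M s′ →
                       ∃[ us ] (Fires (restrict M 𝒯) s us s′ × us ↭ ts)
    permuteToReduced zero    {ts = []}     _   [] _    = [] , [] , ↭-refl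
    permuteToReduced (suc n) {s} {ts} len p term with findFirst (𝒯 s) ts
    permuteToReduced (suc n) {s} len p term | inj₁ (firstAt {as} {t} none t∈ bs)
      with Fires-split M (as ++ [ t ]) (subst (λ l → Fires M s l _) (sym (++-assoc as [ t ] bs)) p)
    ... | mid , p₁ , p₂ with D1 s t as mid t∈ none p₁
    -- The remaining path is rebuilt from the output of `D1` and is not a subterm of `p`, hence the
    -- induction on length.
    ...   | st ∷ q with permuteToReduced n (suc-injective (trans (sym (↭-length (shift t as bs))) len))
                          (Fires-++ M q p₂) term
    ...     | us , r , us↭ = t ∷ us , (t∈ , st) ∷ r , ↭-trans (prep t us↭) (↭-sym (shift t as bs))
    permuteToReduced (suc n) {s} {ts@(_ ∷ _)} len p@(st ∷ _) term | inj₂ none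
      with D0 s (λ s-term → s-term (_ , _ , st))
    ... | t , t∈ , enabled = contradiction (t , D2 s t ts _ t∈ none enabled p) term

  -- Paths with many `tω` and a bounded number of `T*`

  module Counting (M : TransitionSystem) (tω : TransitionSystem.Transition M)
                  (T* : Pred (TransitionSystem.Transition M) 0ℓ) where
    open TransitionSystem M

    #tω #T* : List Transition → ℕ
    #tω = count (_≡ tω)
    #T* = count T*

    -- `End` is a parameter because paths cut from an execution end in `Reachable M`, whereas
    -- permuting needs `Terminal M`, taken in the original system even for paths of the reduced one.
    record RichPath (End : Pred State 0ℓ) (N C : ℕ) (s : State) : Set where
      constructor richPath
      field
        {labels} : List Transition
        {end}    : State
        fires    : Fires M s labels end
        ends     : End end
        many     : N ≤ #tω labels
        few      : #T* labels ≤ C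

    Abundant : Pred State 0ℓ → ℕ → Pred State 0ℓ
    Abundant End C s = ∀ N → RichPath End N C s

    module _ {End : Pred State 0ℓ} where

      antitone : ∀ {m n C s} → m ≤ n → RichPath End n C s → RichPath End m C s
      antitone m≤n (richPath p e many few) = richPath p e (≤-trans m≤n many) few

      prepend : ∀ {N C s us s′} → Fires M s us s′ → RichPath End N C s′ →
                RichPath End (#tω us + N) (#T* us + C) s
      prepend {us = us} p (richPath {vs} q e many few) = richPath (Fires-++ M p q) e
        (subst (_ ≤_) (sym (count-++ _ us vs)) (+-monoʳ-≤ (#tω us) many))
        (subst (_≤ _) (sym (count-++ T* us vs)) (+-monoʳ-≤ (#T* us) few))

      Abundant-prepend : ∀ {C s us s′} → Fires M s us s′ → Abundant End C s′ →
                         Abundant End (#T* us + C) s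
      Abundant-prepend {us = us} p ab N = antitone (m≤n+m N (#tω us)) (prepend p (ab N))

    -- From an execution to rich paths

    module FromExecution (finT : Finite {Transition} U)
      (e : Execution M (FullEdge M))
      (inf : OccursInfinitelyOften M e tω)
      (fin : ∀ t → t ∈ T* → ¬ OccursInfinitelyOften M e t) where
      open Execution e

      -- Each member of `T*` stops occurring at some point; as there are finitely many transitions,
      -- one point serves for all.
      T*-free-from : ∃[ n ] (∀ {i} → n ≤ i → label i ∉ T*)
      T*-free-from =
        let n , q = uniformBound {P = T*} {Q = λ n t → ∀ i → n ≤ i → ¬ label i ≡ t}
                      (proj₁ finT , λ _ → proj₂ finT _)
                      (λ m≤n q i n≤i → q i (≤-trans m≤n n≤i))
                      λ {t} t∈ → stable λ none → fin t t∈ λ n → stable λ never →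
                        none (n , λ i n≤i eq → never (i , n≤i , eq))
        in n , λ {i} n≤i ∈T* → q ∈T* i n≤i refl

      private
        n₀ = proj₁ T*-free-from

      -- Freedom from `T*` is conditional because the prefix up to `n₀`, where `T*` may occur, is
      -- also obtained here.
      segment : ∀ {m n} → m ≤′ n →
                ∃[ us ] (Fires M (state m) us (state n) × (n₀ ≤ m → All (_∉ T*) us))
      segment ≤′-refl     = [] , [] , λ _ → []
      segment (≤′-step p) with segment p | steps _
      ... | us , q , free | _ , _ , st = us ∷ʳ _ , Fires-++ M q (st ∷ []) , λ n₀≤m →
        ++⁺ (free n₀≤m) (proj₂ T*-free-from (≤-trans n₀≤m (≤′⇒≤ p)) ∷ [])

      richPathFrom : ∀ N {m} → n₀ ≤ m → RichPath (Reachable M) N 0 (state m)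
      richPathFrom zero    n₀≤m = richPath [] (Execution-Reachable M e _) z≤n z≤n
      richPathFrom (suc N) {m} n₀≤m with inf m
      ... | i , m≤i , refl with segment (≤⇒≤′ m≤i) | steps i
      ...   | us , p , free | _ , _ , st =
        subst (λ C → RichPath (Reachable M) (suc N) C (state m)) (cong (_+ 0) noT*)
          (antitone (subst (λ k → suc N ≤ k + N) (sym countω) (s≤s (m≤n+m N (#tω us))))
            (prepend (Fires-++ M p (st ∷ [])) (richPathFrom N (m≤n⇒m≤1+n n₀≤i))))
        where
        n₀≤i : n₀ ≤ i
        n₀≤i = ≤-trans n₀≤m m≤i
        noT* : #T* (us ∷ʳ tω) ≡ 0
        noT* = count-none T* (++⁺ (free n₀≤m) (proj₂ T*-free-from n₀≤i ∷ []))
        countω : #tω (us ∷ʳ tω) ≡ suc (#tω us)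
        countω = trans (count-++ _ us [ tω ])
          (trans (cong (#tω us +_) (count-accept _ [] refl)) (+-comm (#tω us) 1))

      initial-Abundant : ∃[ C ] Abundant (Reachable M) C initial
      -- The budget is the number of `T*` labels before `n₀`; after that nothing is spent.
      initial-Abundant with segment {0} {n₀} (≤⇒≤′ z≤n)
      ... | us , p , _ = _ ,
        Abundant-prepend (subst (λ s → Fires M s us _) starts p) λ N → richPathFrom N ≤-refl

    -- One length `B` suffices to leave any of the finitely many reachable states for a terminal
    -- one, so the extension costs at most `B` occurrences of `T*`, whatever `N` is.
    Abundant-Terminal : Finite (Reachable M) → AGEFTerminating M → ∀ {C s} →
                        Abundant (Reachable M) C s → ∃[ B ] Abundant (Terminal M) B s
    Abundant-Terminal finR agef {C} {s} ab = C + B , extended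
      where
      ShortExit : ℕ → Pred State 0ℓ
      ShortExit n s = ∃[ ts ] ∃[ s′ ] (Fires M s ts s′ × Terminal M s′ × length ts ≤ n)

      exits : ∃[ B ] (∀ {s} → s ∈ Reachable M → ShortExit B s)
      exits = uniformBound {Q = ShortExit} finR
        (λ m≤n (ts , s′ , p , term , l) → ts , s′ , p , term , ≤-trans l m≤n)
        λ {s} r → let s′ , term , ts , p = agef s r in length ts , ts , s′ , p , term , ≤-refl

      B : ℕ
      B = proj₁ exits

      extended : Abundant (Terminal M) (C + B) s
      extended N with ab N
      ... | richPath {us} p r many few with proj₂ exits r
      ...   | ts , s′ , q , term , short = richPath (Fires-++ M p q) term
        (subst (N ≤_) (sym (count-++ _ us ts)) (m≤n⇒m≤n+o _ many))
        (subst (_≤ C + B) (sym (count-++ T* us ts))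
          (+-mono-≤ few (≤-trans (count≤length T* ts) short)))

    -- From rich paths to an execution

    module ToExecution (finR : Finite (Reachable M)) {End : Pred State 0ℓ} where

      -- The stretch of the execution already decided on: it ends with `tω`, in a state from which a
      -- further plan can be made.
      record Plan (s : State) : Set where
        constructor plan
        field
          reachable : Reachable M s
          chunk     : List Transition
          {next}    : State
          fires     : Fires M s (chunk ∷ʳ tω) next
          budget    : ℕ
          abundant  : Abundant End budget next

        -- Bounds the `T*` labels still to come: those of the stretch itself and those allowed
        -- afterwards.
        weight : ℕ
        weight = #T* (chunk ∷ʳ tω) + budget
      open Plan

      -- For each `N`, a path with `N + 1` occurrences of `tω` is cut after the first one. The state
      -- at the cut and the budget left take finitely many values, so one pair serves for all `N`.
      makePlan : ∀ {C s} → Reachable M s → Abundant End C s → Σ (Plan s) λ p → weight p ≤ C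
      makePlan {C} {s} r ab =
        let (s′ , c) , _ , all = infinitePigeonhole {P = Target} {R = Leads}
                                   finite leads-antitone leads
            -- The way to the common pair may vary with `N`; any one will do, here that for 0.
            ts , p , le , _ = all 0
        in plan r ts p c (λ N → proj₂ (proj₂ (proj₂ (all N)))) , le
        where
        Target : Pred (State × ℕ) 0ℓ
        Target (s′ , c) = Reachable M s′ × c ≤ C

        Leads : ℕ → Pred (State × ℕ) 0ℓ
        Leads N (s′ , c) = ∃[ ts ]
          (Fires M s (ts ∷ʳ tω) s′ × #T* (ts ∷ʳ tω) + c ≤ C × RichPath End N c s′)

        finite : Finite Target
        finite = cartesianProduct (proj₁ finR) (upTo (suc C)) ,
          λ (r , c≤C) → ∈-cartesianProduct⁺ (proj₂ finR r) (∈-upTo⁺ (s≤s c≤C))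

        leads-antitone : ∀ {m n x} → m ≤ n → Leads n x → Leads m x
        leads-antitone m≤n (ts , p , le , rich) = ts , p , le , antitone m≤n rich

        leads : ∀ N → ∃[ x ] (x ∈ Target × Leads N x)
        leads N with ab (suc N)
        ... | richPath {us} p e many few with findFirst (_≡ tω) us
        ...   | inj₂ none = contradiction (subst (suc N ≤_) (count-none _ none) many) λ ()
        ...   | inj₁ (firstAt {as} none refl bs)
          with Fires-split M (as ∷ʳ tω) (subst (λ l → Fires M s l _) (sym (++-assoc as [ tω ] bs)) p)
        -- The budget left is exactly what the rest of the path spends.
        ...     | s′ , p₁ , p₂ = (s′ , #T* bs) ,
          (Reachable-Fires M r p₁ , ≤-trans (m≤n+m _ _) le) , as , p₁ , le ,
          richPath p₂ e (s≤s⁻¹ (subst (suc N ≤_) countω many)) ≤-refl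
          where
          le : #T* (as ∷ʳ tω) + #T* bs ≤ C
          le = subst (_≤ C) (trans (cong #T* (sym (++-assoc as [ tω ] bs))) (count-++ T* (as ∷ʳ tω) bs)) few
          countω : #tω (as ++ tω ∷ bs) ≡ suc (#tω bs)
          countω = trans (count-++ _ as (tω ∷ bs)) (cong₂ _+_ (count-none _ none) (count-accept _ bs refl))

      replan : ∀ {s} → Reachable M s → (c : ℕ) → Abundant End c s → Plan s
      replan r _ ab = proj₁ (makePlan r ab)

      Config : Set
      Config = Σ State Plan

      current : Config → State
      current = proj₁

      remaining : Config → ℕ
      remaining (_ , p) = length (chunk p)

      cost : Config → ℕ
      cost (_ , p) = weight p

      emit : Config → Transition
      emit (_ , plan _ []      _ _ _) = tω
      emit (_ , plan _ (t ∷ _) _ _ _) = t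

      advance : Config → Config
      advance (_ , plan r []       (st ∷ []) c ab) = _ , replan (Reachable-Fires M r (st ∷ [])) c ab
      advance (_ , plan r (t ∷ ts) (st ∷ p)  c ab) = _ , plan (Reachable-Fires M r (st ∷ [])) ts p c ab

      advance-edge : ∀ c → FullEdge M (current c) (emit c) (current (advance c))
      advance-edge (_ , plan r []      (st ∷ []) _ _) = r , Reachable-Fires M r (st ∷ []) , st
      advance-edge (_ , plan r (_ ∷ _) (st ∷ _)  _ _) = r , Reachable-Fires M r (st ∷ []) , st

      -- Within a chunk this is an equality. After the final `tω`, the new plan weighs at most the
      -- old `budget` by `makePlan`.
      advance-cost : ∀ c → #T* [ emit c ] + cost (advance c) ≤ cost c
      advance-cost (_ , plan r []       (st ∷ []) c ab) =
        +-monoʳ-≤ (#T* [ tω ]) (proj₂ (makePlan (Reachable-Fires M r (st ∷ [])) ab))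
      advance-cost (_ , plan r (t ∷ ts) (st ∷ p)  c ab) = ≤-reflexive
        (trans (sym (+-assoc (#T* [ t ]) (#T* (ts ∷ʳ tω)) c))
               (cong (_+ c) (sym (count-++ T* [ t ] (ts ∷ʳ tω)))))

      advance-≤ : ∀ c → cost (advance c) ≤ cost c
      advance-≤ c = ≤-trans (m≤n+m _ (#T* [ emit c ])) (advance-cost c)

      advance-drop : ∀ c → emit c ∈ T* → cost (advance c) < cost c
      advance-drop c c∈ = subst (λ k → k + cost (advance c) ≤ cost c)
        (count-accept T* [] c∈) (advance-cost c)

      emit-tω : ∀ c → remaining c ≡ 0 → emit c ≡ tω
      emit-tω (_ , plan _ [] _ _ _) _ = refl

      advance-remaining : ∀ c {k} → remaining c ≡ suc k → remaining (advance c) ≡ k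
      advance-remaining (_ , plan _ (_ ∷ _) (_ ∷ _) _ _) eq = suc-injective eq

      run : Config → ℕ → Config
      run c zero    = c
      run c (suc i) = advance (run c i)

      run-tω : ∀ c k n → remaining (run c n) ≡ k → ∃[ i ] (n ≤ i × emit (run c i) ≡ tω)
      run-tω c zero    n eq = n , ≤-refl , emit-tω (run c n) eq
      run-tω c (suc k) n eq with run-tω c k (suc n) (advance-remaining (run c n) eq)
      ... | i , n<i , eq′ = i , <⇒≤ n<i , eq′

      execution : ∀ {C} → Abundant End C initial → HasExecution M (FullEdge M) tω T*
      execution ab = record
        { state  = current ∘ run c
        ; label  = emit ∘ run c
        ; starts = refl
        ; steps  = advance-edge ∘ run c
        } , (λ n → run-tω c _ n refl) , λ t t∈ occurs →
          -- The cost never rises, and each occurrence of `t` would lower it strictly.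
          no-infinite-descent (cost ∘ run c) (advance-≤ ∘ run c)
            λ n → let i , n≤i , eq = occurs n in i , n≤i ,
              advance-drop (run c i) (subst T* (sym eq) t∈)
        where
        c : Config
        c = initial , replan ([] , []) _ ab

-- Transfer between the full and the reduced state space

theorem6 : ExcludedMiddle 0ℓ →
    (M : TransitionSystem) → let open TransitionSystem M in
    Finite {Transition} U →
    Finite (Reachable M) →
    (𝒯 : State → Pred Transition 0ℓ) →
    IsStubborn M 𝒯 →
    AGEFTerminating M →
    (tω : Transition) (T* : Pred Transition 0ℓ) →
    HasExecution M (FullEdge M) tω T* ⇔ HasExecution M (ReducedEdge M 𝒯) tω T*
theorem6 em M finT finR 𝒯 stubborn agef tω T* =
  -- The converse holds because every reduced edge is a full edge.
  mk⇔ toReduced (mapExecution M (ReducedEdge⇒FullEdge M))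
  where
  open Classical em
  module Full = Counting M tω T*
  module Reduced = Counting (restrict M 𝒯) tω T*

  reducePath : ∀ {N C s} → Full.RichPath (Terminal M) N C s → Reduced.RichPath (Terminal M) N C s
  reducePath (Full.richPath p term many few) with permuteToReduced M stubborn _ refl p term
  ... | us , q , us↭ = Reduced.richPath q term
    (subst (_ ≤_) (sym (count-↭ _ us↭)) many) (subst (_≤ _) (sym (count-↭ T* us↭)) few)

  toReduced : HasExecution M (FullEdge M) tω T* → HasExecution M (ReducedEdge M 𝒯) tω T*
  toReduced (e , inf , fin) =
    let _ , ab  = Full.FromExecution.initial-Abundant finT e inf fin
        _ , ab′ = Full.Abundant-Terminal finR agef ab
    in unrestrictExecution M (Reduced.ToExecution.execution finR′ (reducePath ∘ ab′))
    where
    finR′ : Finite (Reachable (restrict M 𝒯))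
    finR′ = proj₁ finR , λ (us , p) → proj₂ finR (us , Fires-unrestrict M p)
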